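{- Let $G=(V,E,w)$ be a finite connected graph with $|V|=n\ge2$ and weights $w:E\to\mathbb{R}_{>0}$. Then $$\operatorname{OPT}_{\mathrm{free}}(G,w)=\min_{T\in\mathcal T_{\mathrm{conn}}^{\mathrm{bin}}(G)}\ \sum_{xy\in E}w_{xy}\operatorname{diam}_{d_G}\bigl(C_T(x,y)\bigr).$$ In particular, the free optimum $\operatorname{OPT}_{\mathrm{free}}(G,w)$ is attained by the diameter labeling $u_T^{\mathrm{diam}}$ of some connected binary hierarchy $T\in\mathcal T_{\mathrm{conn}}^{\mathrm{bin}}(G)$.
   Context: $d_G$ is the shortest-path metric of the support graph $(V,E)$ with every edge of length $1$; the weights are not edge lengths. An ultrametric on $V$ is a metric $u$ on $V$ with $u(x,y)\le\max\{u(x,z),u(z,y)\}$ for all $x,y,z$; it dominates $d_G$ if $u(x,y)\ge d_G(x,y)$ for all $x,y\in V$. $\operatorname{OPT}_{\mathrm{free}}(G,w)$ is the minimum (a priori, infimum) of $\sum_{xy\in E}w_{xy}u(x,y)$ over all ultrametrics $u$ on $V$ dominating $d_G$. A rooted binary hierarchy $T$ on $V$ is a rooted tree whose leaves are the vertices of $V$ and whose internal nodes have exactly two children; each node is identified with the set of leaves below it (a cluster), and $C_T(x,y)$ is the cluster of the lowest common ancestor of $x,y$. $\mathcal T_{\mathrm{conn}}^{\mathrm{bin}}(G)$ is the set of rooted binary hierarchies on $V$ all of whose clusters induce connected subgraphs of $G$. $\operatorname{diam}_{d_G}(S)=\max_{a,b\in S}d_G(a,b)$. The diameter labeling is $u_T^{\mathrm{diam}}(x,x)=0$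 and $u_T^{\mathrm{diam}}(x,y)=\operatorname{diam}_{d_G}(C_T(x,y))$ for $x\neq y$. -}

module Defs where

open import Algebra.Bundles using (CommutativeRing)
open import Algebra.Core using (Op₁; Op₂)
open import Algebra.Structures using (IsCommutativeRing)
open import Data.Bool.Base using (if_then_else_)
open import Data.Fin.Base using (Fin; _<_)
open import Data.Fin.Properties using (_≟_; _<?_; any?)
open import Data.Fin.Subset using (Subset; _∈_; ⁅_⁆; _∪_)
open import Data.Fin.Subset.Properties using (_∈?_)
open import Data.List.Base
  using (List; []; _∷_; _++_; allFin; cartesianProduct; filter; foldr; map)
open import Data.List.Extrema.Nat using (max)
open import Data.List.Relation.Binary.Permutation.Propositional using (_↭_)
open import Data.List.Relation.Unary.All using (All)
open import Data.Nat.Base as ℕ using (ℕ; zero; suc; z≤n; s≤s)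
open import Data.Nat.Properties using (suc-injective)
open import Data.Product.Base using (Σ; ∃; _×_; _,_; proj₁; proj₂)
open import Data.Tree.Binary using (Tree; leaf; node; module Leaves)
open import Data.Unit.Base using (⊤)
open import Function.Base using (_∘_)
open import Level using (Level; 0ℓ; _⊔_) renaming (suc to lsuc)
open import Relation.Binary.Bundles using (DecTotalOrder)
open import Relation.Binary.Construct.Closure.ReflexiveTransitive
  using (Star; ε; _◅_)
open import Relation.Binary.Core using (Rel)
open import Relation.Binary.Definitions using (Symmetric; Irreflexive)
  renaming (Decidable to Decidable₂)
open import Relation.Binary.PropositionalEquality.Core using (_≡_; refl; cong)
open import Relation.Binary.Structures using (IsDecTotalOrder)
open import Relation.Nullary.Decidable
  using (Dec; yes; no; does; map′; _×-dec_)
open import Relation.Nullary.Negation using (¬_; contradiction)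
open import Relation.Unary using (Pred; Decidable)

import Algebra.Construct.NaturalChoice.Max as Max
import Algebra.Definitions.RawMonoid as RawMonoid
import Function.Metric.Definitions as MetricDefinitions
import Function.Metric.Structures as MetricStructures

-- A Dedekind-complete linearly ordered field.  Classically ℝ is, up to
-- isomorphism, the only model; the decidable order is the classical
-- trichotomy of ℝ.
record CompleteOrderedField (c ℓ₁ ℓ₂ : Level) : Set (lsuc (c ⊔ ℓ₁ ⊔ ℓ₂)) where
  infix  8 -_
  infixl 7 _*_
  infixl 6 _+_
  infix  4 _≈_ _≤_ _>_
  field
    Carrier           : Set c
    _≈_               : Rel Carrier ℓ₁
    _≤_               : Rel Carrier ℓ₂
    _+_ _*_           : Op₂ Carrier
    -_                : Op₁ Carrier
    0# 1#             : Carrier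
    isCommutativeRing : IsCommutativeRing _≈_ _+_ _*_ -_ 0# 1#
    1≉0               : ¬ 1# ≈ 0#
    inverse           : ∀ x → ¬ x ≈ 0# → ∃ λ y → x * y ≈ 1#
    isDecTotalOrder   : IsDecTotalOrder _≈_ _≤_
    +-monoˡ-≤         : ∀ z {x y} → x ≤ y → x + z ≤ y + z
    *-nonNegative     : ∀ {x y} → 0# ≤ x → 0# ≤ y → 0# ≤ x * y

  UpperBound : ∀ {p} → Pred Carrier p → Carrier → Set (c ⊔ ℓ₂ ⊔ p)
  UpperBound P b = ∀ x → P x → x ≤ b

  field
    supremum : (P : Pred Carrier (c ⊔ ℓ₁ ⊔ ℓ₂)) → ∃ P → ∃ (UpperBound P) →
               ∃ λ s → UpperBound P s × (∀ b → UpperBound P b → s ≤ b)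

  commutativeRing : CommutativeRing c ℓ₁
  commutativeRing = record { isCommutativeRing = isCommutativeRing }

  decTotalOrder : DecTotalOrder c ℓ₁ ℓ₂
  decTotalOrder = record { isDecTotalOrder = isDecTotalOrder }

  open Max (DecTotalOrder.totalOrder decTotalOrder) public
    using () renaming (_⊔_ to _max_)

  _>_ : Rel Carrier (ℓ₁ ⊔ ℓ₂)
  x > y = y ≤ x × ¬ y ≈ x

  fromℕ : ℕ → Carrier
  fromℕ k = RawMonoid._×_ (CommutativeRing.+-rawMonoid commutativeRing) k 1#

  IsInfimum : ∀ {i} {I : Set i} → (I → Carrier) → Carrier → Set (c ⊔ ℓ₂ ⊔ i)
  IsInfimum f v = (∀ i → v ≤ f i) × (∀ b → (∀ i → b ≤ f i) → b ≤ v)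

  IsMinimum : ∀ {i} {I : Set i} → (I → Carrier) → Carrier → Set (ℓ₁ ⊔ ℓ₂ ⊔ i)
  IsMinimum f v = (∃ λ i → f i ≈ v) × (∀ i → v ≤ f i)

record Graph (n : ℕ) : Set₁ where
  field
    Adj        : Rel (Fin n) 0ℓ
    adj?       : Decidable₂ Adj
    adj-sym    : Symmetric Adj
    adj-irrefl : Irreflexive _≡_ Adj

  -- Each edge {x,y} is listed once, with its smaller endpoint first.
  edges : List (Fin n × Fin n)
  edges = filter (λ (x , y) → (x <? y) ×-dec adj? x y)
                 (cartesianProduct (allFin n) (allFin n))

  Walk : Rel (Fin n) 0ℓ
  Walk = Star Adj

  length : ∀ {x y} → Walk x y → ℕ
  length ε       = 0
  length (_ ◅ p) = suc (length p)

  WalkOfLength : Fin n → Fin n → ℕ → Set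
  WalkOfLength x y k = Σ (Walk x y) λ p → length p ≡ k

  Connected : Set
  Connected = ∀ x y → Walk x y

  InducesConnected : Subset n → Set
  InducesConnected S =
    ∀ {x y} → x ∈ S → y ∈ S → Star (λ a b → a ∈ S × b ∈ S × Adj a b) x y

  walkOfLength? : ∀ x y → Decidable (WalkOfLength x y)
  walkOfLength? x y zero    = map′ (λ { refl → ε , refl }) (λ { (ε , _) → refl }) (x ≟ y)
  walkOfLength? x y (suc k) =
    map′ (λ { (_ , e , p , eq) → e ◅ p , cong suc eq })
         (λ { (e ◅ p , eq) → _ , e , p , suc-injective eq })
         (any? λ z → adj? x z ×-dec walkOfLength? z y k)

least : ∀ {p} {P : Pred ℕ p} → Decidable P → ∀ k → P k →
        ∃ λ m → P m × (∀ {j} → P j → m ℕ.≤ j)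
least P? zero    p = 0 , p , λ _ → z≤n
least P? (suc k) p with P? 0
... | yes p₀ = 0 , p₀ , λ _ → z≤n
... | no ¬p₀ =
  let m , q , m-least = least (P? ∘ suc) k p in
  suc m , q , λ { {zero} p₀ → contradiction p₀ ¬p₀ ; {suc j} r → s≤s (m-least r) }

module GraphMetric {n : ℕ} (G : Graph n) (connected : Graph.Connected G) where
  open Graph G

  shortest : ∀ x y → ∃ λ k → WalkOfLength x y k ×
                             (∀ {j} → WalkOfLength x y j → k ℕ.≤ j)
  shortest x y = least (walkOfLength? x y) (length (connected x y)) (connected x y , refl)

  dist : Fin n → Fin n → ℕ
  dist x y = proj₁ (shortest x y)

  elements : Subset n → List (Fin n)
  elements S = filter (_∈? S) (allFin n)

  diam : Subset n → ℕ
  diam S = max 0 (map (λ (a , b) → dist a b) (cartesianProduct (elements S) (elements S)))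

-- Internal nodes carry no label.  The order of the two children is
-- irrelevant to everything below.
BinTree : ℕ → Set
BinTree n = Tree ⊤ (Fin n)

module _ {n : ℕ} where

  cluster : BinTree n → Subset n
  cluster (leaf x)     = ⁅ x ⁆
  cluster (node l _ r) = cluster l ∪ cluster r

  clusters : BinTree n → List (Subset n)
  clusters (leaf x)         = cluster (leaf x) ∷ []
  clusters t@(node l _ r) = cluster t ∷ clusters l ++ clusters r

  -- Every vertex is the label of exactly one leaf.
  IsHierarchy : BinTree n → Set
  IsHierarchy t = Leaves.toList t ↭ allFin n

  -- The subtree rooted at the lowest common ancestor of x and y
  -- (meaningful when both are leaves of the tree).
  lca : BinTree n → Fin n → Fin n → BinTree n
  lca t@(leaf _)     x y = t
  lca t@(node l _ r) x y =
    if does ((x ∈? cluster l) ×-dec (y ∈? cluster l)) then lca l x y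
    else if does ((x ∈? cluster r) ×-dec (y ∈? cluster r)) then lca r x y
    else t

  lcaCluster : BinTree n → Fin n → Fin n → Subset n
  lcaCluster t x y = cluster (lca t x y)

ConnectedHierarchy : ∀ {n} → Graph n → Set
ConnectedHierarchy {n} G =
  Σ (BinTree n) λ t → IsHierarchy t × All (Graph.InducesConnected G) (clusters t)

module Weighted {c ℓ₁ ℓ₂ : Level} (ℝ : CompleteOrderedField c ℓ₁ ℓ₂) where
  open CompleteOrderedField ℝ

  -- The values of w on non-edges are unconstrained and never used.
  record IsEdgeWeight {n} (G : Graph n) (w : Fin n → Fin n → Carrier)
                      : Set (ℓ₁ ⊔ ℓ₂) where
    open Graph G
    field
      symmetric : ∀ {x y} → Adj x y → w x y ≈ w y x
      positive  : ∀ {x y} → Adj x y → w x y > 0#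

  record IsUltrametric {a} {A : Set a} (u : A → A → Carrier)
                       : Set (a ⊔ c ⊔ ℓ₁ ⊔ ℓ₂) where
    open MetricDefinitions using (TriangleInequality)
    open MetricStructures {A = A} _≡_ _≈_ _≤_ 0# using (IsGeneralMetric)
    field
      isMetric      : IsGeneralMetric _+_ u
      ultratriangle : TriangleInequality _≤_ _max_ u

  module Optimization {n : ℕ} (G : Graph n) (connected : Graph.Connected G)
                      (w : Fin n → Fin n → Carrier) where
    open Graph G
    open GraphMetric G connected

    Dominates : (Fin n → Fin n → Carrier) → Set ℓ₂
    Dominates u = ∀ x y → fromℕ (dist x y) ≤ u x y

    DominatingUltrametric : Set (c ⊔ ℓ₁ ⊔ ℓ₂)
    DominatingUltrametric =
      Σ (Fin n → Fin n → Carrier) λ u → IsUltrametric u × Dominates u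

    sumOverEdges : (Fin n → Fin n → Carrier) → Carrier
    sumOverEdges f = foldr (λ (x , y) s → f x y + s) 0# edges

    cost : (Fin n → Fin n → Carrier) → Carrier
    cost u = sumOverEdges λ x y → w x y * u x y

    IsOPTfree : Carrier → Set (c ⊔ ℓ₁ ⊔ ℓ₂)
    IsOPTfree = IsInfimum {I = DominatingUltrametric} λ (u , _) → cost u

    diamCost : BinTree n → Carrier
    diamCost t = sumOverEdges λ x y → w x y * fromℕ (diam (lcaCluster t x y))

    diamLabeling : BinTree n → Fin n → Fin n → Carrier
    diamLabeling t x y =
      if does (x ≟ y) then 0# else fromℕ (diam (lcaCluster t x y))

{-# OPTIONS --safe #-}
-- The diameter labeling of a hierarchy is a dominating ultrametric of cost
-- diamCost, so it suffices to find one connected hierarchy T with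
-- diamCost T ≤ cost u for every dominating ultrametric u.  For a single u,
-- single linkage works: merge along a u-minimal edge xy between two trees of
-- the current forest.  By the ultrametric inequality all u-distances inside
-- the merged cluster are ≤ u x y, and u x y ≤ u a b for every edge ab first
-- joined by this merge; domination then bounds the diameter of the cluster,
-- which is that of the lowest common ancestor of a and b, by u a b.
--
-- A T that is good for all u at once comes from induction on the number of
-- trees: among the best completions after each possible merge, take a
-- cheapest one.
module Submission where

open import Defs
open import Algebra.Bundles using (CommutativeRing)
import Algebra.Construct.NaturalChoice.Max as Max
import Algebra.Properties.Ring as RingProperties
open import Data.Fin.Base using (Fin)
open import Data.Fin.Properties using (_≟_)
open import Data.Fin.Subset using (Subset; _∈_; _∉_; _⊆_; _∪_)
open import Data.Fin.Subset.Properties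
  using (_∈?_; x∈⁅x⁆; x∈⁅y⁆⇒x≡y; x∈p∪q⁺; x∈p∪q⁻; p⊆p∪q; q⊆p∪q)
open import Data.List.Base
  using (List; []; _∷_; _++_; allFin; cartesianProduct; concatMap; filter; foldr; length; map)
import Data.List.Extrema as Extrema
import Data.List.Extrema.Nat as ℕ-Extrema
open import Data.List.Membership.Propositional as List using ()
open import Data.List.Membership.Propositional.Properties
  using ( ∈-++⁺ˡ; ∈-++⁺ʳ; ∈-++⁻; ∈-allFin; ∈-cartesianProduct⁺; ∈-cartesianProduct⁻
        ; ∈-concatMap⁺; ∈-concatMap⁻; ∈-filter⁺; ∈-filter⁻; ∈-map⁺; ∈-map⁻)
open import Data.List.Properties
  using (++-assoc; ++-identityʳ; concatMap-map; concatMap-pure; length-map; length-tabulate)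
open import Data.List.Relation.Binary.Permutation.Propositional
  using (_↭_; prep; swap; ↭-refl; ↭-sym; ↭-trans; ↭-reflexive; ↭⇒↭ₛ)
open import Data.List.Relation.Binary.Permutation.Propositional.Properties
  using (All-resp-↭; ∈-resp-↭; ↭-length; ++⁺ˡ; shifts)
import Data.List.Relation.Binary.Permutation.Setoid.Properties as Permutationₛ
open import Data.List.Relation.Unary.All as All using (All; []; _∷_)
import Data.List.Relation.Unary.All.Properties as Allₚ
open import Data.List.Relation.Unary.AllPairs using ([]; _∷_)
open import Data.List.Relation.Unary.Any as Any using (Any; here; there)
open import Data.List.Relation.Unary.Unique.Propositional using (Unique)
open import Data.List.Relation.Unary.Unique.Propositional.Properties using (allFin⁺)
open import Data.Nat.Base as ℕ using (ℕ; zero; suc; z≤n; s≤s)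
import Data.Nat.Properties as ℕ
open import Data.Product.Base using (∃; _×_; _,_; proj₁; proj₂; uncurry)
open import Data.Sum.Base using (_⊎_; inj₁; inj₂; [_,_]′)
open import Data.Tree.Binary using (leaf; node; module Leaves)
open import Function.Base using (_∘_; id)
open import Level using (Level)
open import Relation.Binary.Bundles using (DecTotalOrder)
open import Relation.Binary.Construct.Closure.ReflexiveTransitive as Star
  using (ε; _◅_; _◅◅_)
open import Relation.Binary.PropositionalEquality.Core
  using (_≡_; _≢_; refl; sym; trans; cong; subst)
open import Relation.Binary.PropositionalEquality.Properties using (setoid; isEquivalence)
open import Relation.Nullary.Decidable
  using (Dec; yes; no; dec-true; dec-false; ¬?; _×-dec_)
open import Relation.Nullary.Negation using (¬_; contradiction)

module _ {a} {A : Set a} where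

  Unique-++⁻ : ∀ (xs : List A) {ys} → Unique (xs ++ ys) →
               Unique xs × Unique ys × (∀ {x} → x List.∈ xs → x List.∉ ys)
  Unique-++⁻ []       uniq          = [] , uniq , λ ()
  Unique-++⁻ (x ∷ xs) (x∉ ∷ uniq) =
    let uxs , uys , dis = Unique-++⁻ xs uniq in
    Allₚ.++⁻ˡ xs x∉ ∷ uxs , uys ,
    λ { (here refl) x∈ys → All.lookup (Allₚ.++⁻ʳ xs x∉) x∈ys refl
      ; (there x∈xs)     → dis x∈xs }

  Unique-resp-↭ : ∀ {xs ys : List A} → xs ↭ ys → Unique xs → Unique ys
  Unique-resp-↭ xs↭ys = Permutationₛ.Unique-resp-↭ (setoid A) (↭⇒↭ₛ xs↭ys)

  Any⇒↭∷ : ∀ {p} {P : A → Set p} {xs} → Any P xs → ∃ λ x → ∃ λ ys → P x × xs ↭ x ∷ ys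
  Any⇒↭∷ (here px) = _ , _ , px , ↭-refl
  Any⇒↭∷ {xs = z ∷ _} (there any) =
    let x , ys , px , xs↭ = Any⇒↭∷ any in
    x , z ∷ ys , px , ↭-trans (prep z xs↭) (swap z x ↭-refl)

  concatMap-↭ : ∀ {b} {B : Set b} (f : A → List B) {xs ys} →
                xs ↭ ys → concatMap f xs ↭ concatMap f ys
  concatMap-↭ f _↭_.refl          = ↭-refl
  concatMap-↭ f (prep x xs↭ys)    = ++⁺ˡ (f x) (concatMap-↭ f xs↭ys)
  concatMap-↭ f (swap x y xs↭ys)  =
    ↭-trans (shifts (f x) (f y)) (++⁺ˡ (f y) (++⁺ˡ (f x) (concatMap-↭ f xs↭ys)))
  concatMap-↭ f (_↭_.trans p q)   = ↭-trans (concatMap-↭ f p) (concatMap-↭ f q)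

module _ {n : ℕ} where

  leaves : BinTree n → List (Fin n)
  leaves = Leaves.toList

  toDiffList-++ : ∀ (t : BinTree n) xs → Leaves.toDiffList t xs ≡ leaves t ++ xs
  toDiffList-++ (leaf x)     xs = refl
  toDiffList-++ (node l _ r) xs = trans
    (toDiffList-++ l _)
    (trans (cong (leaves l ++_) (toDiffList-++ r xs))
    (trans (sym (++-assoc (leaves l) _ _))
           (cong (_++ xs) (sym (toDiffList-++ l _)))))

  leaves-node : ∀ (l : BinTree n) {m} r → leaves (node l m r) ≡ leaves l ++ leaves r
  leaves-node l r = toDiffList-++ l (leaves r)

  ∈-leaves⇒∈-cluster : ∀ (t : BinTree n) {x} → x List.∈ leaves t → x ∈ cluster t
  ∈-leaves⇒∈-cluster (leaf x) (here refl) = x∈⁅x⁆ x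
  ∈-leaves⇒∈-cluster (node l _ r) {x} x∈t =
    [ x∈p∪q⁺ ∘ inj₁ ∘ ∈-leaves⇒∈-cluster l , x∈p∪q⁺ ∘ inj₂ ∘ ∈-leaves⇒∈-cluster r ]′
      (∈-++⁻ (leaves l) (subst (x List.∈_) (leaves-node l r) x∈t))

  ∈-cluster⇒∈-leaves : ∀ (t : BinTree n) {x} → x ∈ cluster t → x List.∈ leaves t
  ∈-cluster⇒∈-leaves (leaf y) x∈t with refl ← x∈⁅y⁆⇒x≡y y x∈t = here refl
  ∈-cluster⇒∈-leaves (node l _ r) {x} x∈t =
    subst (x List.∈_) (sym (leaves-node l r))
      ([ ∈-++⁺ˡ ∘ ∈-cluster⇒∈-leaves l , ∈-++⁺ʳ (leaves l) ∘ ∈-cluster⇒∈-leaves r ]′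
        (x∈p∪q⁻ _ _ x∈t))

  cluster-nonempty : ∀ (t : BinTree n) → ∃ (_∈ cluster t)
  cluster-nonempty (leaf x)     = x , x∈⁅x⁆ x
  cluster-nonempty (node l _ r) =
    let x , x∈l = cluster-nonempty l in x , x∈p∪q⁺ (inj₁ x∈l)

  Disjoint : Subset n → Subset n → Set
  Disjoint S T = ∀ {x} → x ∈ S → x ∉ T

  Unique-node : ∀ (l : BinTree n) {m} r → Unique (leaves (node l m r)) →
                Unique (leaves l) × Unique (leaves r) × Disjoint (cluster l) (cluster r)
  Unique-node l r uniq =
    let ul , ur , dis = Unique-++⁻ (leaves l) (subst Unique (leaves-node l r) uniq) in
    ul , ur , λ x∈l x∈r → dis (∈-cluster⇒∈-leaves l x∈l) (∈-cluster⇒∈-leaves r x∈r)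

  Both : Fin n → Fin n → BinTree n → Set
  Both x y t = x ∈ cluster t × y ∈ cluster t

  both? : ∀ x y t → Dec (Both x y t)
  both? x y t = (x ∈? cluster t) ×-dec (y ∈? cluster t)

  lca-left : ∀ l {m} r {x y} → Both x y l → lca (node l m r) x y ≡ lca l x y
  lca-left l r {x} {y} xy∈l rewrite dec-true (both? x y l) xy∈l = refl

  lca-right : ∀ l {m} r {x y} → ¬ Both x y l → Both x y r →
              lca (node l m r) x y ≡ lca r x y
  lca-right l r {x} {y} ¬xy∈l xy∈r
    rewrite dec-false (both? x y l) ¬xy∈l | dec-true (both? x y r) xy∈r = refl

  lca-root : ∀ l {m} r {x y} → ¬ Both x y l → ¬ Both x y r →
             lca (node l m r) x y ≡ node l m r
  lca-root l r {x} {y} ¬xy∈l ¬xy∈r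
    rewrite dec-false (both? x y l) ¬xy∈l | dec-false (both? x y r) ¬xy∈r = refl

  lcaCluster-⊆ : ∀ t x y → lcaCluster t x y ⊆ cluster t
  lcaCluster-⊆ (leaf _) x y z∈ = z∈
  lcaCluster-⊆ (node l m r) x y {z} z∈ with both? x y l | both? x y r
  ... | yes p | _     = x∈p∪q⁺ (inj₁ (lcaCluster-⊆ l x y
                          (subst ((z ∈_) ∘ cluster) (lca-left l r p) z∈)))
  ... | no ¬p | yes q = x∈p∪q⁺ (inj₂ (lcaCluster-⊆ r x y
                          (subst ((z ∈_) ∘ cluster) (lca-right l r ¬p q) z∈)))
  ... | no ¬p | no ¬q = subst ((z ∈_) ∘ cluster) (lca-root l r ¬p ¬q) z∈

  lca-both : ∀ t {x y} → Both x y t → Both x y (lca t x y)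
  lca-both (leaf _) xy∈t = xy∈t
  lca-both (node l m r) {x} {y} xy∈t with both? x y l | both? x y r
  ... | yes p | _     = subst (Both x y) (sym (lca-left l r p)) (lca-both l p)
  ... | no ¬p | yes q = subst (Both x y) (sym (lca-right l r ¬p q)) (lca-both r q)
  ... | no ¬p | no ¬q = subst (Both x y) (sym (lca-root l r ¬p ¬q)) xy∈t

  lca-sym : ∀ t x y → lca t x y ≡ lca t y x
  lca-sym (leaf _) x y = refl
  lca-sym (node l m r) x y with both? x y l | both? x y r
  ... | yes (p , p′) | _ =
    trans (lca-left l r (p , p′)) (trans (lca-sym l x y) (sym (lca-left l r (p′ , p))))
  ... | no ¬p | yes (q , q′) =
    trans (lca-right l r ¬p (q , q′))
      (trans (lca-sym r x y) (sym (lca-right l r (λ (a , b) → ¬p (b , a)) (q′ , q))))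
  ... | no ¬p | no ¬q =
    trans (lca-root l r ¬p ¬q)
      (sym (lca-root l r (λ (a , b) → ¬p (b , a)) (λ (a , b) → ¬q (b , a))))

  lcaCluster-ultra : ∀ t → Unique (leaves t) → ∀ x z y →
                     lcaCluster t x y ⊆ lcaCluster t x z ⊎
                     lcaCluster t x y ⊆ lcaCluster t z y
  lcaCluster-ultra (leaf _) _ x z y = inj₁ id
  lcaCluster-ultra t@(node l m r) uniq x z y
    with ul , ur , dis ← Unique-node l r uniq
    with both? x z l | both? x z r | both? z y l | both? z y r
  ... | no ¬xz∈l | no ¬xz∈r | _ | _ rewrite lca-root l {m} r ¬xz∈l ¬xz∈r =
    inj₁ (lcaCluster-⊆ t x y)
  ... | _ | _ | no ¬zy∈l | no ¬zy∈r rewrite lca-root l {m} r ¬zy∈l ¬zy∈r =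
    inj₂ (lcaCluster-⊆ t x y)
  ... | yes (x∈l , z∈l) | _ | yes (_ , y∈l) | _
    rewrite lca-left l {m} r (x∈l , z∈l) | lca-left l {m} r (z∈l , y∈l)
          | lca-left l {m} r (x∈l , y∈l) = lcaCluster-ultra l ul x z y
  ... | no ¬xz∈l | yes (x∈r , z∈r) | no ¬zy∈l | yes (_ , y∈r)
    rewrite lca-right l {m} r ¬xz∈l (x∈r , z∈r) | lca-right l {m} r ¬zy∈l (z∈r , y∈r)
          | lca-right l {m} r (λ (x∈l , _) → dis x∈l x∈r) (x∈r , y∈r) =
    lcaCluster-ultra r ur x z y
  ... | yes (_ , z∈l) | _ | no _ | yes (z∈r , _) = contradiction z∈r (dis z∈l)
  ... | no _ | yes (_ , z∈r) | yes (z∈l , _) | _ = contradiction z∈r (dis z∈l)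

module _ {n : ℕ} (G : Graph n) (connected : Graph.Connected G) where
  open Graph G
  open GraphMetric G connected

  dist-refl : ∀ x → dist x x ≡ 0
  dist-refl x = ℕ.n≤0⇒n≡0 (proj₂ (proj₂ (shortest x x)) (ε , refl))

  dist≡0⇒≡ : ∀ {x y} → dist x y ≡ 0 → x ≡ y
  dist≡0⇒≡ {x} {y} d≡0 with shortest x y
  ... | 0     , (ε , _) , _ = refl
  ... | suc _ , _       , _ with () ← d≡0

  ∈-elements : ∀ {S x} → x ∈ S → x List.∈ elements S
  ∈-elements {S} {x} x∈S = ∈-filter⁺ (_∈? S) (∈-allFin x) x∈S

  dist≤diam : ∀ {S x y} → x ∈ S → y ∈ S → dist x y ℕ.≤ diam S
  dist≤diam x∈S y∈S = All.lookup (ℕ-Extrema.xs≤max 0 _)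
    (∈-map⁺ _ (∈-cartesianProduct⁺ (∈-elements x∈S) (∈-elements y∈S)))

  diam-elim : ∀ {p} (P : ℕ → Set p) S → P 0 →
              (∀ {x y} → x ∈ S → y ∈ S → P (dist x y)) → P (diam S)
  diam-elim P S p₀ step = ℕ-Extrema.argmax-all id {P = P} p₀
    (Allₚ.map⁺ (All.tabulate λ xy∈ →
      let x∈ , y∈ = ∈-cartesianProduct⁻ (elements S) (elements S) xy∈ in
      step (proj₂ (∈-filter⁻ (_∈? S) {xs = allFin n} x∈))
           (proj₂ (∈-filter⁻ (_∈? S) {xs = allFin n} y∈))))

  diam-mono-⊆ : ∀ {S T} → S ⊆ T → diam S ℕ.≤ diam T
  diam-mono-⊆ {S} {T} S⊆T =
    diam-elim (ℕ._≤ diam T) S z≤n λ x∈S y∈S → dist≤diam (S⊆T x∈S) (S⊆T y∈S)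

module _ {n : ℕ} (G : Graph n) where
  open Graph G hiding (length)

  Forest : Set
  Forest = List (BinTree n)

  Separated : Forest → Fin n → Fin n → Set
  Separated F x y = All (λ t → ¬ Both x y t) F

  Crossing : Forest → Fin n → Fin n → Set
  Crossing F x y = Adj x y × Separated F x y

  crossing? : ∀ F x y → Dec (Crossing F x y)
  crossing? F x y = adj? x y ×-dec All.all? (λ t → ¬? (both? x y t)) F

  crossings : Forest → List (Fin n × Fin n)
  crossings F = filter (uncurry (crossing? F)) (cartesianProduct (allFin n) (allFin n))

  ∈-crossings⁺ : ∀ {F x y} → Crossing F x y → (x , y) List.∈ crossings F
  ∈-crossings⁺ {F} {x} {y} =
    ∈-filter⁺ (uncurry (crossing? F)) (∈-cartesianProduct⁺ (∈-allFin x) (∈-allFin y))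

  ∈-crossings⁻ : ∀ {F e} → e List.∈ crossings F → uncurry (Crossing F) e
  ∈-crossings⁻ {F} e∈ = proj₂ (∈-filter⁻ (uncurry (crossing? F))
    {xs = cartesianProduct (allFin n) (allFin n)} e∈)

  record IsForest (F : Forest) : Set where
    field
      partition : concatMap leaves F ↭ allFin n
      conn      : All (All InducesConnected ∘ clusters) F

    unique : Unique (concatMap leaves F)
    unique = Unique-resp-↭ (↭-sym partition) (allFin⁺ n)

    covers : ∀ x → x List.∈ concatMap leaves F
    covers x = ∈-resp-↭ (↭-sym partition) (∈-allFin x)

  IsForest-resp-↭ : ∀ {F F′} → F ↭ F′ → IsForest F → IsForest F′
  IsForest-resp-↭ F↭F′ isF = record
    { partition = ↭-trans (concatMap-↭ leaves (↭-sym F↭F′)) partition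
    ; conn      = All-resp-↭ F↭F′ conn
    } where open IsForest isF

  head-disjoint : ∀ t {F : Forest} → Unique (concatMap leaves (t ∷ F)) →
                  ∀ {s} → s List.∈ F → Disjoint (cluster t) (cluster s)
  head-disjoint t uniq {s} s∈F x∈t x∈s = proj₂ (proj₂ (Unique-++⁻ (leaves t) uniq))
    (∈-cluster⇒∈-leaves t x∈t)
    (∈-concatMap⁺ leaves (List.lose s∈F (∈-cluster⇒∈-leaves s x∈s)))

  extract : ∀ {F : Forest} {x} → x List.∈ concatMap leaves F →
            ∃ λ t → ∃ λ rest → x ∈ cluster t × F ↭ t ∷ rest
  extract {F} x∈ = Any⇒↭∷
    (Any.map (λ {t} → ∈-leaves⇒∈-cluster t) (∈-concatMap⁻ leaves {xs = F} x∈))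

  StepIn : Subset n → Fin n → Fin n → Set
  StepIn S a b = a ∈ S × b ∈ S × Adj a b

  StepIn-mono-⊆ : ∀ {S T} → S ⊆ T → ∀ {a b} → StepIn S a b → StepIn T a b
  StepIn-mono-⊆ S⊆T (a∈S , b∈S , a~b) = S⊆T a∈S , S⊆T b∈S , a~b

  InducesConnected-∪ : ∀ {S T x y} → InducesConnected S → InducesConnected T →
                       x ∈ S → y ∈ T → Adj x y → InducesConnected (S ∪ T)
  InducesConnected-∪ {S} {T} {x} {y} connS connT x∈S y∈T x~y {p} {q} p∈ q∈
    with x∈p∪q⁻ S T p∈ | x∈p∪q⁻ S T q∈
  ... | inj₁ p∈S | inj₁ q∈S = Star.map (StepIn-mono-⊆ (p⊆p∪q T)) (connS p∈S q∈S)
  ... | inj₂ p∈T | inj₂ q∈T = Star.map (StepIn-mono-⊆ (q⊆p∪q S T)) (connT p∈T q∈T)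
  ... | inj₁ p∈S | inj₂ q∈T =
    Star.map (StepIn-mono-⊆ (p⊆p∪q T)) (connS p∈S x∈S) ◅◅ (p⊆p∪q T x∈S , q⊆p∪q S T y∈T , x~y) ◅
    Star.map (StepIn-mono-⊆ (q⊆p∪q S T)) (connT y∈T q∈T)
  ... | inj₂ p∈T | inj₁ q∈S =
    Star.map (StepIn-mono-⊆ (q⊆p∪q S T)) (connT p∈T y∈T) ◅◅ (q⊆p∪q S T y∈T , p⊆p∪q T x∈S , adj-sym x~y) ◅
    Star.map (StepIn-mono-⊆ (p⊆p∪q T)) (connS x∈S q∈S)

  All-clusters⇒cluster : ∀ {p} {P : Subset n → Set p} t → All P (clusters t) → P (cluster t)
  All-clusters⇒cluster (leaf _)     (p ∷ _) = p
  All-clusters⇒cluster (node _ _ _) (p ∷ _) = p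

  singletons : Forest
  singletons = map leaf (allFin n)

  singletons-isForest : IsForest singletons
  singletons-isForest = record
    { partition = ↭-reflexive
        (trans (concatMap-map leaves leaf (allFin n)) (concatMap-pure (allFin n)))
    ; conn      = Allₚ.map⁺ (All.universal (λ x → singleton x ∷ []) (allFin n))
    }
    where
    singleton : ∀ x → InducesConnected (cluster (leaf x))
    singleton x p∈ q∈ with refl ← x∈⁅y⁆⇒x≡y x p∈ | refl ← x∈⁅y⁆⇒x≡y x q∈ = ε

  record Merge (F : Forest) (x y : Fin n) : Set where
    field
      s t  : BinTree n
      rest : Forest
      x∈s  : x ∈ cluster s
      y∈t  : y ∈ cluster t
      perm : F ↭ s ∷ t ∷ rest

    merged : Forest
    merged = node s _ t ∷ rest

    length-merged : ∀ {k} → length F ≡ suc k → length merged ≡ k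
    length-merged eq = ℕ.suc-injective (trans (sym (↭-length perm)) eq)

    merged-isForest : IsForest F → Adj x y → IsForest merged
    merged-isForest isF x~y with IsForest-resp-↭ perm isF
    ... | record { partition = part ; conn = cs ∷ ct ∷ crest } = record
      { partition = ↭-trans (↭-reflexive (trans
          (cong (_++ concatMap leaves rest) (leaves-node s t))
          (++-assoc (leaves s) (leaves t) _))) part
      ; conn = (InducesConnected-∪ (All-clusters⇒cluster s cs) (All-clusters⇒cluster t ct)
                  x∈s y∈t x~y ∷ Allₚ.++⁺ cs ct) ∷ crest
      }

  merge : ∀ {F x y} → IsForest F → Crossing F x y → Merge F x y
  merge {F} {x} {y} isF (_ , sep)
    with s , F₁ , x∈s , F↭ ← extract {F} (IsForest.covers isF x)
    with ¬both ∷ _ ← All-resp-↭ F↭ sep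
    with ∈-++⁻ (leaves s) (IsForest.covers (IsForest-resp-↭ F↭ isF) y)
  ... | inj₁ y∈s = contradiction (x∈s , ∈-leaves⇒∈-cluster s y∈s) ¬both
  ... | inj₂ y∈F₁ = let t , rest , y∈t , F₁↭ = extract {F₁} y∈F₁ in record
    { x∈s = x∈s ; y∈t = y∈t ; perm = ↭-trans F↭ (prep s F₁↭) }

  exit-edge : ∀ {S x y} → Walk x y → x ∈ S → y ∉ S →
              ∃ λ p → ∃ λ q → p ∈ S × q ∉ S × Adj p q
  exit-edge ε x∈S x∉S = contradiction x∈S x∉S
  exit-edge {S} (_◅_ {j = z} x~z walk) x∈S y∉S with z ∈? S
  ... | yes z∈S = exit-edge walk z∈S y∉S
  ... | no z∉S  = _ , _ , x∈S , z∉S , x~z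

  crossing-exists : Connected → ∀ {s t rest} → IsForest (s ∷ t ∷ rest) →
                    ∃ λ x → ∃ λ y → Crossing (s ∷ t ∷ rest) x y
  crossing-exists connected {s} {t} isF =
    let disjoint = head-disjoint s (IsForest.unique isF)
        a , a∈s = cluster-nonempty s
        b , b∈t = cluster-nonempty t
        p , q , p∈s , q∉s , p~q =
          exit-edge (connected a b) a∈s (λ b∈s → disjoint (here refl) b∈s b∈t)
    in p , q , p~q ,
       (λ (_ , q∈s) → q∉s q∈s) ∷ All.tabulate λ r∈ (p∈r , _) → disjoint r∈ p∈s p∈r

module _ {c ℓ₁ ℓ₂ : Level} (ℝ : CompleteOrderedField c ℓ₁ ℓ₂) where
  open CompleteOrderedField ℝ
  open Weighted ℝ

  private
    module R = CommutativeRing commutativeRing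
    module O = DecTotalOrder decTotalOrder
    module ⊔ = Max O.totalOrder
    open RingProperties R.ring using (-1*x≈-x; -‿involutive; x[y-z]≈xy-xz)

  +-mono-≤ : ∀ {x y u v} → x ≤ y → u ≤ v → x + u ≤ y + v
  +-mono-≤ {x} {y} {u} {v} x≤y u≤v = O.trans (+-monoˡ-≤ u x≤y)
    (O.≤-respˡ-≈ (R.+-comm u y) (O.≤-respʳ-≈ (R.+-comm v y) (+-monoˡ-≤ y u≤v)))

  x≤y⇒0≤y-x : ∀ {x y} → x ≤ y → 0# ≤ y R.- x
  x≤y⇒0≤y-x {x} x≤y = O.≤-respˡ-≈ (R.-‿inverseʳ x) (+-monoˡ-≤ (- x) x≤y)

  0≤y-x⇒x≤y : ∀ {x y} → 0# ≤ y R.- x → x ≤ y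
  0≤y-x⇒x≤y {x} {y} 0≤ = O.≤-respˡ-≈ (R.+-identityˡ x) (O.≤-respʳ-≈
    (R.trans (R.+-assoc y (- x) x)
      (R.trans (R.+-congˡ (R.-‿inverseˡ x)) (R.+-identityʳ y)))
    (+-monoˡ-≤ x 0≤))

  *-monoˡ-≤ : ∀ {w x y} → 0# ≤ w → x ≤ y → w * x ≤ w * y
  *-monoˡ-≤ {w} {x} {y} 0≤w x≤y = 0≤y-x⇒x≤y
    (O.≤-respʳ-≈ (x[y-z]≈xy-xz w y x) (*-nonNegative 0≤w (x≤y⇒0≤y-x x≤y)))

  0≤1 : 0# ≤ 1#
  0≤1 with O.total 0# 1#
  ... | inj₁ 0≤1 = 0≤1
  ... | inj₂ 1≤0 = O.≤-respʳ-≈ (R.trans (-1*x≈-x (- 1#)) (-‿involutive 1#))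
                     (*-nonNegative 0≤-1 0≤-1)
    where
    0≤-1 : 0# ≤ - 1#
    0≤-1 = O.≤-respʳ-≈ (R.+-identityˡ (- 1#)) (x≤y⇒0≤y-x 1≤0)

  fromℕ-mono : ∀ {j k} → j ℕ.≤ k → fromℕ j ≤ fromℕ k
  fromℕ-mono {k = zero}  z≤n       = O.refl
  fromℕ-mono {k = suc k} z≤n       =
    O.≤-respˡ-≈ (R.+-identityˡ 0#) (+-mono-≤ 0≤1 (fromℕ-mono {k = k} z≤n))
  fromℕ-mono             (s≤s j≤k) = +-mono-≤ O.refl (fromℕ-mono j≤k)

  fromℕ≈0⇒≡0 : ∀ k → fromℕ k ≈ 0# → k ≡ 0
  fromℕ≈0⇒≡0 zero    _  = refl
  fromℕ≈0⇒≡0 (suc k) eq = contradiction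
    (O.antisym (O.≤-respˡ-≈ (R.+-identityʳ 1#)
                 (O.trans (fromℕ-mono (s≤s (z≤n {k}))) (O.reflexive eq))) 0≤1)
    1≉0

  -- The default b₀ makes the statement hold for the empty list as well.
  choose-min : ∀ {i b q} {I : Set i} {B : Set b} {Q : I → B → Set q} (f : B → Carrier) →
               B → ∀ xs → (∀ {x} → x List.∈ xs → ∃ (Q x)) →
               ∃ λ b → ∀ {x} → x List.∈ xs → ∃ λ b′ → Q x b′ × f b ≤ f b′
  choose-min f b₀ []       g = b₀ , λ ()
  choose-min f b₀ (x ∷ xs) g
    with b₁ , q ← g (here refl) | b , b-min ← choose-min f b₀ xs (g ∘ there)
    with O.total (f b₁) (f b)
  ... | inj₁ b₁≤b = b₁ , λ
    { (here refl) → b₁ , q , O.refl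
    ; (there x∈)  → let b′ , q′ , b≤b′ = b-min x∈ in b′ , q′ , O.trans b₁≤b b≤b′ }
  ... | inj₂ b≤b₁ = b , λ { (here refl) → b₁ , q , b≤b₁ ; (there x∈) → b-min x∈ }

  module _ {n : ℕ} (G : Graph n) (connected : Graph.Connected G)
           (w : Fin n → Fin n → Carrier) where
    open Graph G hiding (length)
    open GraphMetric G connected
    open Optimization G connected w

    sumOverEdges-mono : ∀ {f g} → (∀ {x y} → Adj x y → f x y ≤ g x y) →
                        sumOverEdges f ≤ sumOverEdges g
    sumOverEdges-mono {f} {g} f≤g = go (All.tabulate λ e∈ →
      proj₂ (proj₂ (∈-filter⁻ _ {xs = cartesianProduct (allFin n) (allFin n)} e∈)))
      where
      go : ∀ {es} → All (uncurry Adj) es →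
           foldr (λ (x , y) s → f x y + s) 0# es ≤
           foldr (λ (x , y) s → g x y + s) 0# es
      go []         = O.refl
      go (e ∷ adjs) = +-mono-≤ (f≤g e) (go adjs)

    sumOverEdges-cong : ∀ {f g} → (∀ {x y} → Adj x y → f x y ≈ g x y) →
                        sumOverEdges f ≈ sumOverEdges g
    sumOverEdges-cong f≈g = O.antisym (sumOverEdges-mono (O.reflexive ∘ f≈g))
                                      (sumOverEdges-mono (O.reflexive ∘ R.sym ∘ f≈g))

    diamLabeling-refl : ∀ t x → diamLabeling t x x ≡ 0#
    diamLabeling-refl t x rewrite dec-true (x ≟ x) refl = refl

    diamLabeling-≢ : ∀ t {x y} → x ≢ y →
                     diamLabeling t x y ≡ fromℕ (diam (lcaCluster t x y))
    diamLabeling-≢ t {x} {y} x≢y rewrite dec-false (x ≟ y) x≢y = refl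

    cost-diamLabeling : ∀ t → cost (diamLabeling t) ≈ diamCost t
    cost-diamLabeling t = sumOverEdges-cong λ {x} {y} x~y →
      R.*-congˡ (R.reflexive (diamLabeling-≢ t λ x≡y → adj-irrefl x≡y x~y))

    module _ (t : BinTree n) (isHierarchy : IsHierarchy t) where

      dist≤diam-lca : ∀ x y → dist x y ℕ.≤ diam (lcaCluster t x y)
      dist≤diam-lca x y = uncurry (dist≤diam G connected) (lca-both t (∈t x , ∈t y))
        where
        ∈t : ∀ z → z ∈ cluster t
        ∈t z = ∈-leaves⇒∈-cluster t (∈-resp-↭ (↭-sym isHierarchy) (∈-allFin z))

      diamLabeling-dominates : Dominates (diamLabeling t)
      diamLabeling-dominates x y with x ≟ y
      ... | yes refl = O.reflexive (R.reflexive (cong fromℕ (dist-refl G connected x)))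
      ... | no _     = fromℕ-mono (dist≤diam-lca x y)

      diamLabeling-nonNegative : ∀ {x y} → 0# ≤ diamLabeling t x y
      diamLabeling-nonNegative {x} {y} =
        O.trans (fromℕ-mono (z≤n {dist x y})) (diamLabeling-dominates x y)

      diamLabeling-indiscernable : ∀ {x y} → diamLabeling t x y ≈ 0# → x ≡ y
      diamLabeling-indiscernable {x} {y} eq = dist≡0⇒≡ G connected (fromℕ≈0⇒≡0 _
        (O.antisym (O.trans (diamLabeling-dominates x y) (O.reflexive eq))
                   (fromℕ-mono (z≤n {dist x y}))))

      diamLabeling-sym : ∀ x y → diamLabeling t x y ≈ diamLabeling t y x
      diamLabeling-sym x y with x ≟ y
      ... | yes refl = R.reflexive (sym (diamLabeling-refl t x))
      ... | no x≢y   = R.reflexive (trans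
        (cong (fromℕ ∘ diam ∘ cluster) (lca-sym t x y))
        (sym (diamLabeling-≢ t (x≢y ∘ sym))))

      diamLabeling-ultra : ∀ x z y →
        diamLabeling t x y ≤ (diamLabeling t x z) max (diamLabeling t z y)
      diamLabeling-ultra x z y with x ≟ y
      ... | yes refl = ⊔.x≤y⇒x≤y⊔z _ diamLabeling-nonNegative
      ... | no x≢y with x ≟ z | z ≟ y
      ...   | yes refl | yes refl = contradiction refl x≢y
      ...   | yes refl | no _     = ⊔.x≤y⇒x≤z⊔y _ O.refl
      ...   | no _     | yes refl = ⊔.x≤y⇒x≤y⊔z _ O.refl
      ...   | no _     | no _
        with lcaCluster-ultra t (Unique-resp-↭ (↭-sym isHierarchy) (allFin⁺ n)) x z y
      ...     | inj₁ ⊆xz = ⊔.x≤y⇒x≤y⊔z _ (fromℕ-mono (diam-mono-⊆ G connected ⊆xz))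
      ...     | inj₂ ⊆zy = ⊔.x≤y⇒x≤z⊔y _ (fromℕ-mono (diam-mono-⊆ G connected ⊆zy))

      diamLabeling-isUltrametric : IsUltrametric (diamLabeling t)
      diamLabeling-isUltrametric = record
        { isMetric = record
          { isSemiMetric = record
            { isQuasiSemiMetric = record
              { isPreMetric = record
                { isProtoMetric = record
                  { isPartialOrder  = O.isPartialOrder
                  ; ≈-isEquivalence = isEquivalence
                  ; cong            = λ { refl refl → R.refl }
                  ; nonNegative     = diamLabeling-nonNegative
                  }
                ; ≈⇒0 = λ { {x} refl → R.reflexive (diamLabeling-refl t x) }
                }
              ; 0⇒≈ = diamLabeling-indiscernable
              }
            ; sym = diamLabeling-sym
            }
          ; triangle = λ x y z → O.trans (diamLabeling-ultra x y z) (⊔.⊔-lub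
              (O.≤-respˡ-≈ (R.+-identityʳ _) (+-mono-≤ O.refl diamLabeling-nonNegative))
              (O.≤-respˡ-≈ (R.+-identityˡ _) (+-mono-≤ diamLabeling-nonNegative O.refl)))
          }
        ; ultratriangle = diamLabeling-ultra
        }

    diamUltrametric : ConnectedHierarchy G → DominatingUltrametric
    diamUltrametric (t , isHierarchy , _) =
      diamLabeling t ,
      diamLabeling-isUltrametric t isHierarchy ,
      diamLabeling-dominates t isHierarchy

    -- The single-linkage invariant: forests reached by merging along
    -- u-minimal crossing edges satisfy it.
    record Compatible (F : Forest G) (u : Fin n → Fin n → Carrier) : Set (c Level.⊔ ℓ₂) where
      field
        tight   : ∀ {t p q a b} → t List.∈ F → Both p q t → Crossing G F a b → u p q ≤ u a b
        labeled : ∀ {t a b} → t List.∈ F → Both a b t → Adj a b →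
                  fromℕ (diam (lcaCluster t a b)) ≤ u a b

    Compatible-resp-↭ : ∀ {F F′ u} → F ↭ F′ → Compatible F u → Compatible F′ u
    Compatible-resp-↭ F↭F′ compat = record
      { tight   = λ t∈ pq∈t (a~b , sep) →
                  tight (∈-resp-↭ (↭-sym F↭F′) t∈) pq∈t (a~b , All-resp-↭ (↭-sym F↭F′) sep)
      ; labeled = λ t∈ → labeled (∈-resp-↭ (↭-sym F↭F′) t∈)
      } where open Compatible compat

    MinimalCrossing : Forest G → (Fin n → Fin n → Carrier) → Fin n × Fin n → Set ℓ₂
    MinimalCrossing F u (x , y) = ∀ {a b} → Crossing G F a b → u x y ≤ u a b

    module _ (u : Fin n → Fin n → Carrier)
             (isUltra : IsUltrametric u) (dominates : Dominates u) where
      open IsUltrametric isUltra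
      open import Function.Metric.Structures {A = Fin n} _≡_ _≈_ _≤_ 0#
        using (module IsGeneralMetric)
      open IsGeneralMetric isMetric using (nonNegative; ≈⇒0) renaming (sym to u-sym)

      ultra-≤ : ∀ {p q v} r → u p r ≤ v → u r q ≤ v → u p q ≤ v
      ultra-≤ {p} {q} r pr≤v rq≤v = O.trans (ultratriangle p r q) (⊔.⊔-lub pr≤v rq≤v)

      singletons-compatible : Compatible (singletons G) u
      singletons-compatible = record
        { tight   = λ t∈ pq∈t _ →
            O.trans (O.reflexive (≈⇒0 (same t∈ pq∈t))) nonNegative
        ; labeled = λ t∈ ab∈t a~b → contradiction a~b (adj-irrefl (same t∈ ab∈t))
        }
        where
        same : ∀ {t p q} → t List.∈ singletons G → Both p q t → p ≡ q
        same t∈ (p∈ , q∈) with x , _ , refl ← ∈-map⁻ leaf t∈ =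
          trans (x∈⁅y⁆⇒x≡y x p∈) (sym (x∈⁅y⁆⇒x≡y x q∈))

      module _ {s t : BinTree n} {rest : Forest G} {x y : Fin n}
               (uniq : Unique (concatMap leaves (node s _ t ∷ rest)))
               (compat : Compatible (s ∷ t ∷ rest) u)
               (x∈s : x ∈ cluster s) (y∈t : y ∈ cluster t)
               (xy-crossing : Crossing G (s ∷ t ∷ rest) x y)
               (xy-minimal : MinimalCrossing (s ∷ t ∷ rest) u (x , y)) where
        open Compatible compat

        within-merged : ∀ {p q} → Both p q (node s _ t) → u p q ≤ u x y
        within-merged {p} {q} (p∈ , q∈) =
          ultra-≤ x (to-x p∈) (O.≤-respˡ-≈ (u-sym q x) (to-x q∈))
          where
          to-x : ∀ {p} → p ∈ cluster s ∪ cluster t → u p x ≤ u x y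
          to-x p∈ with x∈p∪q⁻ (cluster s) (cluster t) p∈
          ... | inj₁ p∈s = tight (here refl) (p∈s , x∈s) xy-crossing
          ... | inj₂ p∈t = ultra-≤ y (tight (there (here refl)) (p∈t , y∈t) xy-crossing)
                                     (O.reflexive (u-sym y x))

        coarsen : ∀ {a b} → Crossing G (node s _ t ∷ rest) a b → Crossing G (s ∷ t ∷ rest) a b
        coarsen (a~b , ¬st ∷ sep) =
          a~b , (λ (a∈ , b∈) → ¬st (x∈p∪q⁺ (inj₁ a∈) , x∈p∪q⁺ (inj₁ b∈)))
              ∷ (λ (a∈ , b∈) → ¬st (x∈p∪q⁺ (inj₂ a∈) , x∈p∪q⁺ (inj₂ b∈)))
              ∷ sep

        labeled-merged : ∀ {a b} → Both a b (node s _ t) → Adj a b →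
                         fromℕ (diam (lcaCluster (node s _ t) a b)) ≤ u a b
        labeled-merged {a} {b} ab∈@(a∈ , _) a~b with both? a b s | both? a b t
        ... | yes ab∈s | _ rewrite lca-left s {_} t ab∈s = labeled (here refl) ab∈s a~b
        ... | no ab∉s | yes ab∈t rewrite lca-right s {_} t ab∉s ab∈t =
          labeled (there (here refl)) ab∈t a~b
        ... | no ab∉s | no ab∉t rewrite lca-root s {_} t ab∉s ab∉t =
          diam-elim G connected (λ k → fromℕ k ≤ u a b) (cluster s ∪ cluster t) nonNegative
            λ p∈ q∈ → O.trans (dominates _ _) (O.trans (within-merged (p∈ , q∈))
              (xy-minimal (a~b , ab∉s ∷ ab∉t ∷ All.tabulate λ r∈ (a∈r , _) →
                head-disjoint G (node s _ t) uniq r∈ a∈ a∈r)))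

        merged-compatible : Compatible (node s _ t ∷ rest) u
        merged-compatible = record
          { tight   = λ { (here refl) pq∈ ab →
                            O.trans (within-merged pq∈) (xy-minimal (coarsen ab))
                        ; (there r∈) pq∈ ab → tight (there (there r∈)) pq∈ (coarsen ab) }
          ; labeled = λ { (here refl) → labeled-merged
                        ; (there r∈)  → labeled (there (there r∈)) }
          }

    module _ (isWeight : IsEdgeWeight G w) where
      open IsEdgeWeight isWeight

      cost-mono : ∀ {f g} → (∀ {x y} → Adj x y → f x y ≤ g x y) → cost f ≤ cost g
      cost-mono f≤g = sumOverEdges-mono λ x~y → *-monoˡ-≤ (proj₁ (positive x~y)) (f≤g x~y)

      Bounds : Forest G → ConnectedHierarchy G → Set (c Level.⊔ ℓ₁ Level.⊔ ℓ₂)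
      Bounds F (t , _) = (u : DominatingUltrametric) → Compatible F (proj₁ u) →
                         diamCost t ≤ cost (proj₁ u)

      best-completion : ∀ k F → length F ≡ suc k → IsForest G F → ∃ (Bounds F)
      best-completion zero (t ∷ []) refl isF with conn ∷ [] ← IsForest.conn isF =
        ( t
        , ↭-trans (↭-reflexive (sym (++-identityʳ (leaves t)))) (IsForest.partition isF)
        , conn ) ,
        λ u compat → cost-mono λ {x} {y} →
          Compatible.labeled compat (here refl) (∈t x , ∈t y)
        where
        ∈t : ∀ x → x ∈ cluster t
        ∈t x = ∈-leaves⇒∈-cluster t
          (subst (x List.∈_) (++-identityʳ (leaves t)) (IsForest.covers isF x))
      best-completion (suc k) F@(_ ∷ _ ∷ _) eq isF =
        let x₀ , y₀ , crossing₀ = crossing-exists G connected isF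
            cs            = crossings G F
            e₀∈cs         = ∈-crossings⁺ G {F} crossing₀
            T , T-minimal = choose-min (diamCost ∘ proj₁) (proj₁ (after e₀∈cs)) cs after
        in T , λ U@(u , _) compat →
          let e∈cs = argmin-all (uncurry u) {P = List._∈ cs} e₀∈cs (All.tabulate id)
              T′ , T′-bounds , T≤T′ = T-minimal e∈cs
          in O.trans T≤T′ (T′-bounds U compat λ ab →
               All.lookup (f[argmin]≤f[xs] {f = uncurry u} (x₀ , y₀) cs) (∈-crossings⁺ G {F} ab))
        where
        open Extrema O.totalOrder using (argmin-all; f[argmin]≤f[xs])

        BoundsVia : Fin n × Fin n → ConnectedHierarchy G → Set (c Level.⊔ ℓ₁ Level.⊔ ℓ₂)
        BoundsVia e (t , _) = (u : DominatingUltrametric) → Compatible F (proj₁ u) →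
          MinimalCrossing F (proj₁ u) e → diamCost t ≤ cost (proj₁ u)

        after : ∀ {e} → e List.∈ crossings G F → ∃ (BoundsVia e)
        after {x , y} e∈ =
          let crossing = ∈-crossings⁻ G {F} e∈
              m = merge G isF crossing
              open Merge m
              merged-forest = merged-isForest isF (proj₁ crossing)
              T , T-bounds  = best-completion k merged (length-merged eq) merged-forest
          in T , λ U@(u , isUltra , dominates) compat minimal → T-bounds U
               (merged-compatible u isUltra dominates (IsForest.unique merged-forest)
                 (Compatible-resp-↭ perm compat) x∈s y∈t
                 (proj₁ crossing , All-resp-↭ perm (proj₂ crossing))
                 λ (a~b , sep) → minimal (a~b , All-resp-↭ (↭-sym perm) sep))

      optimal-hierarchy : 1 ℕ.≤ n → ∃ λ (T : ConnectedHierarchy G) →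
        ∀ (u : DominatingUltrametric) → diamCost (proj₁ T) ≤ cost (proj₁ u)
      optimal-hierarchy (s≤s {n = k} _) =
        let T , T-bounds = best-completion k (singletons G)
              (trans (length-map leaf (allFin n)) (length-tabulate id)) (singletons-isForest G)
        in T , λ u → T-bounds u (uncurry (singletons-compatible _) (proj₂ u))

corollary2 : ∀ {c ℓ₁ ℓ₂} (ℝ : CompleteOrderedField c ℓ₁ ℓ₂) →
    let open CompleteOrderedField ℝ in
    let open Weighted ℝ in
    ∀ {n : ℕ} → 2 ℕ.≤ n →
    (G : Graph n) (connected : Graph.Connected G)
    (w : Fin n → Fin n → Carrier) → IsEdgeWeight G w →
    let open Optimization G connected w in
    ∃ λ (opt : Carrier) →
    IsOPTfree opt ×
    IsMinimum (λ (T : ConnectedHierarchy G) → diamCost (proj₁ T)) opt ×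
    (∃ λ (T : ConnectedHierarchy G) →
    IsUltrametric (diamLabeling (proj₁ T)) ×
    Dominates (diamLabeling (proj₁ T)) ×
    cost (diamLabeling (proj₁ T)) ≈ opt)
corollary2 ℝ 2≤n G connected w isWeight =
  diamCost t ,
  (T-optimal , λ b b≤ → O.trans (b≤ (diamUltrametric′ T)) (O.reflexive (cost≈ t))) ,
  ((T , O.Eq.refl) , λ T′ →
    O.trans (T-optimal (diamUltrametric′ T′)) (O.reflexive (cost≈ (proj₁ T′)))) ,
  T , proj₁ (proj₂ (diamUltrametric′ T)) , proj₂ (proj₂ (diamUltrametric′ T)) , cost≈ t
  where
  open CompleteOrderedField ℝ using (decTotalOrder)
  open Weighted.Optimization ℝ G connected w
  module O = DecTotalOrder decTotalOrder
  diamUltrametric′ = diamUltrametric ℝ G connected w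
  cost≈            = cost-diamLabeling ℝ G connected w
  optimal          = optimal-hierarchy ℝ G connected w isWeight (ℕ.<⇒≤ 2≤n)
  T                = proj₁ optimal
  t                = proj₁ T
  T-optimal        = proj₂ optimal
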